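{- Let $n$ be a positive integer, let $v=4n+2$, and let $X$ be a $v$-set partitioned into two subsets $\{a_0,a_1,\dots,a_{2n}\}$ and $\{b_0,b_1,\dots,b_{2n}\}$ (each of size $2n+1$). Let $G$ be the complete graph on the $2n+1$ vertices $a_0b_0,\,a_1b_1,\dots,a_{2n}b_{2n}$, and let $\mathcal{C}$ be an Eulerian cycle of $G$ (a closed walk traversing every edge of $G$ exactly once). Then $$h=\sum_{\{\alpha_0,\alpha_1,\alpha_2\}\subseteq\{0,\dots,2n\}}\begin{pmatrix} a_{\alpha_0}&a_{\alpha_1}&a_{\alpha_2}\\ b_{\alpha_0}&b_{\alpha_1}&b_{\alpha_2}\end{pmatrix}+T(\mathcal{C}),$$ where the sum runs over all $3$-element subsets of $\{0,\dots,2n\}$, is a $(2,3,4n+2)$-halving.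
   Context: Let $X$ be a $v$-set and let $\binom{X}{i}$ denote the set of $i$-subsets of $X$. Elements of $\binom{X}{k}$ are called blocks. A set $\{x_0,\dots,x_i\}$ is written as the string $x_0\cdots x_i$. A $\mathbb{Z}$-collection of blocks is a function $f:\binom{X}{k}\to\mathbb{Z}$; it is identified with the formal $\mathbb{Z}$-linear combination of blocks $\sum_{B} f(B)\,B$. Trades. For integers $0\le t\le k\le v-t$, a $\mathrm{T}(t,k,v)$ trade is a function $f:\binom{X}{k}\to\mathbb{Z}$ such that for every $A\in\binom{X}{t}$, $\sum_{B\in\binom{X}{k},\,A\subseteq B} f(B)=0$. Write $f=f_0-f_1$ with $f_0=\max(f,0)$ and $f_1=\max(-f,0)$ (the two legs). The volume of the trade is $\sum_B f_0(B)=\sum_B f_1(B)$ (the number of blocks, counted with multiplicity, in each leg). A trade is simple if it contains no repeated blocks, i.e. $f(B)\in\{ -1,0,1\}$ for every block $B$. A $(t,k,v)$-halving is a simple $\mathrm{T}(t,k,v)$ trade with volume $\binom{v}{k}/2$. Notation for $k=3$. Products of distinct points denote the block consisting of these points, and products of sums are expanded multilinearly. For disjoint blocks $x_0x_1x_2$ and $y_0y_1y_2$, $$\begin{pmatrix} x_0&x_1&x_2\\ y_0&y_1&y_2\end{pmatrix}:=(x_0-y_0)(x_1-y_1)(x_2-y_2),$$ a formal combination of $8$ blocks with coefficients $\pm1$. Given a graph $G$ whose vertices are the pairs $a_ib_i$, and a cycle (closed walk without repeated edges, possibly with repeated vertices) $\mathcal{C}=(a_{i_0}b_{i_0},a_{i_1}b_{i_1},\dots,a_{i_m}b_{i_m})$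 with $i_m=i_0$ in $G$, define $$T(\mathcal{C}):=\sum_{(a_ib_i,\,a_jb_j)\in\mathcal{C}} \Big(a_ib_i(a_j+b_j)-a_jb_j(a_i+b_i)\Big),$$ where the sum is over the edges of $\mathcal{C}$ directed in the order in which $\mathcal{C}$ traverses them, i.e. over the consecutive pairs $(i,j)=(i_s,i_{s+1})$, $0\le s<m$. -}

module Defs where

open import Data.Bool.Base using (if_then_else_)
import Data.Bool.Properties as Bool
open import Data.Fin.Base as Fin using (Fin; inject₁; fromℕ)
import Data.Fin.Properties as Fin
open import Data.Fin.Subset using (Subset; inside; outside; ⁅_⁆; _∪_; _⊆_; ∣_∣)
open import Data.Fin.Subset.Properties using (_⊆?_)
open import Data.Integer.Base using (ℤ; +_; -_; _+_; _-_; _*_; _⊔_; 0ℤ; 1ℤ; -1ℤ)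
open import Data.List.Base
  using (List; []; _∷_; [_]; _++_; map; filter; foldr; allFin; cartesianProduct)
open import Data.List.Membership.Propositional using (_∈_)
open import Data.List.Membership.Propositional.Properties
  using (∈-map⁺; ∈-map⁻; ∈-++⁺ˡ; ∈-++⁺ʳ)
open import Data.List.Relation.Unary.All using ([])
open import Data.List.Relation.Unary.AllPairs using ([]; _∷_)
open import Data.List.Relation.Unary.Any using (here)
open import Data.List.Relation.Unary.Unique.Propositional using (Unique)
import Data.List.Relation.Unary.Unique.Propositional.Properties as Unique
open import Data.Nat.Base as ℕ using (ℕ; zero; suc; _≤_)
open import Data.Nat.Combinatorics using (_C_)
import Data.Nat.Properties as ℕ
open import Data.Product using (∃!)
open import Data.Product.Base using (∃; _×_; _,_; proj₁; proj₂; map₁)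
open import Data.Sum.Base using (_⊎_)
import Data.Vec.Base as Vec
open import Data.Vec.Properties using (≡-dec; ∷-injectiveʳ)
open import Function.Definitions using (Injective)
open import Relation.Binary.PropositionalEquality
  using (_≡_; _≢_; refl; sym; trans; cong; ≢-sym)
open import Relation.Nullary using (¬_; does; _×-dec_)

Σ[_] : {A : Set} → List A → (A → ℤ) → ℤ
Σ[ xs ] f = foldr (λ x s → f x + s) 0ℤ xs

-- The ground set is Fin v; a Block v k is one of its k-subsets.

Block : ℕ → ℕ → Set
Block v k = ∃ λ (B : Subset v) → ∣ B ∣ ≡ k

with-0 : ∀ {v k} → Block v k → Block (suc v) (suc k)
with-0 (B , e) = inside Vec.∷ B , cong suc e

without-0 : ∀ {v k} → Block v k → Block (suc v) k
without-0 (B , e) = outside Vec.∷ B , e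

blocks : ∀ v k → List (Block v k)
blocks zero    zero    = [ Vec.[] , refl ]
blocks zero    (suc k) = []
blocks (suc v) zero    = map without-0 (blocks v zero)
blocks (suc v) (suc k) = map with-0 (blocks v k) ++ map without-0 (blocks v (suc k))

Block-≡ : ∀ {v k} {B B′ : Block v k} → proj₁ B ≡ proj₁ B′ → B ≡ B′
Block-≡ {B = B , e} {B′ = .B , e′} refl = cong (B ,_) (ℕ.≡-irrelevant e e′)

blocks-complete : ∀ v k (B : Block v k) → B ∈ blocks v k
blocks-complete zero    zero    (Vec.[] , refl) = here refl
blocks-complete (suc v) zero    (outside Vec.∷ B , e) =
  ∈-map⁺ without-0 (blocks-complete v zero (B , e))
blocks-complete (suc v) (suc k) (inside Vec.∷ B , refl) =
  ∈-++⁺ˡ (∈-map⁺ with-0 (blocks-complete v k (B , refl)))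
blocks-complete (suc v) (suc k) (outside Vec.∷ B , e) =
  ∈-++⁺ʳ _ (∈-map⁺ without-0 (blocks-complete v (suc k) (B , e)))

blocks-unique : ∀ v k → Unique (blocks v k)
blocks-unique zero    zero    = [] ∷ []
blocks-unique zero    (suc k) = []
blocks-unique (suc v) zero    =
  Unique.map⁺ (λ eq → Block-≡ (∷-injectiveʳ (cong proj₁ eq))) (blocks-unique v zero)
blocks-unique (suc v) (suc k) =
  Unique.++⁺
    (Unique.map⁺ (λ eq → Block-≡ (∷-injectiveʳ (cong proj₁ eq))) (blocks-unique v k))
    (Unique.map⁺ (λ eq → Block-≡ (∷-injectiveʳ (cong proj₁ eq))) (blocks-unique v (suc k)))
    disjoint
  where
  disjoint : ∀ {B} → ¬ (B ∈ map with-0 (blocks v k) × B ∈ map without-0 (blocks v (suc k)))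
  disjoint (p , q) with ∈-map⁻ with-0 p | ∈-map⁻ without-0 q
  ... | _ , _ , eq | _ , _ , eq′ with cong proj₁ (trans (sym eq) eq′)
  ... | ()

Collection : ℕ → ℕ → Set
Collection v k = Block v k → ℤ

infixl 6 _+ᶜ_ _-ᶜ_

_+ᶜ_ : ∀ {v k} → Collection v k → Collection v k → Collection v k
(f +ᶜ g) B = f B + g B

_-ᶜ_ : ∀ {v k} → Collection v k → Collection v k → Collection v k
(f -ᶜ g) B = f B - g B

Σᶜ[_] : ∀ {A : Set} {v k} → List A → (A → Collection v k) → Collection v k
Σᶜ[ xs ] F B = Σ[ xs ] (λ x → F x B)

record IsTrade (t k v : ℕ) (f : Collection v k) : Set where
  field
    t≤k      : t ≤ k
    k+t≤v    : k ℕ.+ t ≤ v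
    balanced : (A : Block v t) →
               Σ[ filter (λ B → proj₁ A ⊆? proj₁ B) (blocks v k) ] f ≡ 0ℤ

leg₀ leg₁ : ∀ {v k} → Collection v k → Collection v k
leg₀ f B = f B ⊔ 0ℤ
leg₁ f B = (- f B) ⊔ 0ℤ

HasVolume : ∀ {v k} → Collection v k → ℕ → Set
HasVolume {v} {k} f m =
  Σ[ blocks v k ] (leg₀ f) ≡ + m × Σ[ blocks v k ] (leg₁ f) ≡ + m

IsSimple : ∀ {v k} → Collection v k → Set
IsSimple f = ∀ B → f B ≡ -1ℤ ⊎ f B ≡ 0ℤ ⊎ f B ≡ 1ℤ

-- The volume condition says volume = (v C k) / 2 exactly, without the rounding
-- of natural-number division.
record IsHalving (t k v : ℕ) (f : Collection v k) : Set where
  field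
    isTrade  : IsTrade t k v f
    isSimple : IsSimple f
    volume   : ∃ λ m → HasVolume f m × 2 ℕ.* m ≡ v C k

-- The block xyz as a formal combination.  It is the zero collection when
-- x, y, z are not distinct, since ⁅ x ⁆ ∪ ⁅ y ⁆ ∪ ⁅ z ⁆ then has size below 3.
⟦_,_,_⟧ : ∀ {v} → Fin v → Fin v → Fin v → Collection v 3
⟦ x , y , z ⟧ B =
  if does (≡-dec Bool._≟_ (proj₁ B) (⁅ x ⁆ ∪ ⁅ y ⁆ ∪ ⁅ z ⁆)) then 1ℤ else 0ℤ

-- Formal ℤ-linear combinations of points, as lists of terms (coefficient , point).
LinComb : ℕ → Set
LinComb v = List (ℤ × Fin v)

pt : ∀ {v} → Fin v → LinComb v
pt x = [ 1ℤ , x ]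

infixl 6 _⊕_ _⊖_

_⊕_ : ∀ {v} → LinComb v → LinComb v → LinComb v
p ⊕ q = p ++ q

_⊖_ : ∀ {v} → LinComb v → LinComb v → LinComb v
p ⊖ q = p ++ map (map₁ (λ c → - c)) q

infix 7 _·_·_

_·_·_ : ∀ {v} → LinComb v → LinComb v → LinComb v → Collection v 3
(p · q · r) B =
  Σ[ p ] λ (c , x) → Σ[ q ] λ (d , y) → Σ[ r ] λ (e , z) → c * d * e * ⟦ x , y , z ⟧ B

array : ∀ {v} (x₀ x₁ x₂ y₀ y₁ y₂ : Fin v) → Collection v 3
array x₀ x₁ x₂ y₀ y₁ y₂ = (pt x₀ ⊖ pt y₀) · (pt x₁ ⊖ pt y₁) · (pt x₂ ⊖ pt y₂)

-- The 3-subsets of Fin N, each listed once as an increasing triple.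
triples : ∀ N → List (Fin N × Fin N × Fin N)
triples N =
  filter (λ (i , j , k) → (i Fin.<? j) ×-dec (j Fin.<? k))
         (cartesianProduct (allFin N) (cartesianProduct (allFin N) (allFin N)))

record IsPartition {N v : ℕ} (a b : Fin N → Fin v) : Set where
  field
    a-injective : Injective _≡_ _≡_ a
    b-injective : Injective _≡_ _≡_ b
    disjoint    : ∀ i j → a i ≢ b j
    covers      : ∀ x → (∃ λ i → a i ≡ x) ⊎ (∃ λ i → b i ≡ x)

-- Simple graphs on Fin N; vertex i stands for the pair aᵢbᵢ.
record Graph (N : ℕ) : Set₁ where
  field
    Adj    : Fin N → Fin N → Set
    symm   : ∀ {i j} → Adj i j → Adj j i
    irrefl : ∀ {i} → ¬ Adj i i

complete : ∀ N → Graph N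
complete N = record { Adj = _≢_ ; symm = ≢-sym ; irrefl = λ i≢i → i≢i refl }

-- Step s of the walk goes from src s to tgt s.
record ClosedWalk {N : ℕ} (G : Graph N) : Set where
  field
    len    : ℕ
    vertex : Fin (suc len) → Fin N
    closed : vertex (fromℕ len) ≡ vertex Fin.zero
    step   : ∀ s → Graph.Adj G (vertex (inject₁ s)) (vertex (Fin.suc s))

  src tgt : Fin len → Fin N
  src s = vertex (inject₁ s)
  tgt s = vertex (Fin.suc s)

  Traverses : Fin len → Fin N → Fin N → Set
  Traverses s i j = (src s ≡ i × tgt s ≡ j) ⊎ (src s ≡ j × tgt s ≡ i)

IsEulerian : ∀ {N} {G : Graph N} → ClosedWalk G → Set
IsEulerian {G = G} W =
  ∀ i j → Graph.Adj G i j → ∃! _≡_ (λ s → ClosedWalk.Traverses W s i j)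

module _ {N v : ℕ} (a b : Fin N → Fin v) where

  T : {G : Graph N} → ClosedWalk G → Collection v 3
  T W = Σᶜ[ allFin len ] λ s → term (src s) (tgt s)
    where
    open ClosedWalk W
    term : Fin N → Fin N → Collection v 3
    term i j = (pt (a i) · pt (b i) · (pt (a j) ⊕ pt (b j)))
            -ᶜ (pt (a j) · pt (b j) · (pt (a i) ⊕ pt (b i)))

  h : {G : Graph N} → ClosedWalk G → Collection v 3
  h W = Σᶜ[ triples N ] (λ (i , j , k) → array (a i) (a j) (a k) (b i) (b j) (b k))
     +ᶜ T W

{-# OPTIONS --safe #-}
module Submission where

-- Pair h with a weight w on blocks of the form w{x,y,z} = (P x + P y + P z)(Q x + Q y + Q z).
-- An array is an alternating sum in three variables, so it kills this expression, which has
-- degree 2; the edge term from i to j contributes φ i - φ j, so T telescopes along the closed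
-- walk.  The indicator of containing a given pair is such a weight, and so is the constant 9:
-- hence h is balanced and has total 0.  On the other hand every coefficient of h is ±1: a
-- block with three different indices occurs in exactly one array and not in T, while a block
-- aᵢbᵢz occurs in no array and only in the term of the edge joining i to the index of z.  So the two legs have equal volume, half the number of all blocks.

open import Defs
open import Data.Nat.Base using (ℕ; _+_; _*_; _<_)
open import Data.Fin.Base using (Fin)

import Data.Bool.Properties as Bool
open import Data.Bool.Base using (if_then_else_)
import Data.Fin.Base as Fin
import Data.Fin.Properties as Fin
open import Data.Fin.Subset using (Subset; inside; outside; ⊥; ⁅_⁆; _∪_; ∣_∣)
  renaming (_∈_ to _∈ˢ_; _∉_ to _∉ˢ_)
open import Data.Fin.Subset.Properties
  using (_⊆?_; _∈?_; x∈⁅x⁆; x∈⁅y⁆⇒x≡y; ∣⁅x⁆∣≡1; x∈p∪q⁺; x∈p∪q⁻;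
         ∪-assoc; ∪-comm; ∪-identityˡ; ∪-identityʳ)
open import Data.Integer.Base as ℤ using (ℤ; +_; 0ℤ; 1ℤ; -1ℤ; _⊔_)
import Data.Integer.Properties as ℤ
open import Data.Integer.Solver using (module +-*-Solver)
open import Data.List.Base
  using (List; []; _∷_; filter; length; tabulate; allFin; cartesianProduct; map)
open import Data.List.Membership.Propositional using (_∈_)
open import Data.List.Membership.Propositional.Properties
  using (∈-filter⁺; ∈-filter⁻; ∈-cartesianProduct⁺; ∈-allFin)
open import Data.List.Properties using (length-map; length-++)
open import Data.List.Relation.Unary.All using (All; []; _∷_; lookup)
open import Data.List.Relation.Unary.AllPairs using ([]; _∷_)
open import Data.List.Relation.Unary.Any using (here; there)
open import Data.List.Relation.Unary.Unique.Propositional using (Unique)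
import Data.List.Relation.Unary.Unique.Propositional.Properties as Unique
open import Data.Nat.Base as ℕ using (zero; suc)
open import Data.Nat.Combinatorics using (nCk+nC[k+1]≡[n+1]C[k+1])
  renaming (_C_ to _choose_)
import Data.Nat.Properties as ℕ
open import Data.Product.Base using (∃; _×_; _,_; proj₁; proj₂)
open import Data.Sum.Base using (_⊎_; inj₁; inj₂; [_,_]′; map₂)
import Data.Vec.Base as Vec
open import Data.Vec.Properties using (≡-dec)
open import Function.Base using (_∘_; id)
open import Level using (Level)
open import Relation.Binary.Definitions using (tri<; tri≈; tri>)
open import Relation.Binary.PropositionalEquality
  using (_≡_; _≢_; refl; sym; trans; cong; cong₂; subst; module ≡-Reasoning)
open import Relation.Nullary using (¬_; Dec; yes; no; does; contradiction)
open import Relation.Nullary.Decidable using (dec-true; dec-false)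
open import Relation.Unary using (Pred; Decidable)

open +-*-Solver using (solve; con; _:+_; _:-_; _:*_; _:=_)
open ≡-Reasoning

private
  variable
    A D : Set
    p : Level
    P : Set p
    v N : ℕ

-- Integer sums over lists

Σ-cong : ∀ (xs : List A) {f g : A → ℤ} → (∀ {x} → x ∈ xs → f x ≡ g x) → Σ[ xs ] f ≡ Σ[ xs ] g
Σ-cong []       eq = refl
Σ-cong (x ∷ xs) eq = cong₂ ℤ._+_ (eq (here refl)) (Σ-cong xs (eq ∘ there))

Σ-zero : ∀ (xs : List A) {f : A → ℤ} → (∀ {x} → x ∈ xs → f x ≡ 0ℤ) → Σ[ xs ] f ≡ 0ℤ
Σ-zero []       eq = refl
Σ-zero (x ∷ xs) eq = cong₂ ℤ._+_ (eq (here refl)) (Σ-zero xs (eq ∘ there))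

Σ-+ : ∀ (xs : List A) (f g : A → ℤ) → Σ[ xs ] (λ x → f x ℤ.+ g x) ≡ Σ[ xs ] f ℤ.+ Σ[ xs ] g
Σ-+ []       f g = refl
Σ-+ (x ∷ xs) f g rewrite Σ-+ xs f g =
  solve 4 (λ a b c d → (a :+ b) :+ (c :+ d) := (a :+ c) :+ (b :+ d)) refl
    (f x) (g x) (Σ[ xs ] f) (Σ[ xs ] g)

Σ-*ˡ : ∀ (xs : List A) c (f : A → ℤ) → Σ[ xs ] (λ x → c ℤ.* f x) ≡ c ℤ.* Σ[ xs ] f
Σ-*ˡ []       c f = sym (ℤ.*-zeroʳ c)
Σ-*ˡ (x ∷ xs) c f rewrite Σ-*ˡ xs c f = sym (ℤ.*-distribˡ-+ c (f x) (Σ[ xs ] f))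

Σ-swap : ∀ (xs : List A) (ys : List D) (f : A → D → ℤ) →
         Σ[ xs ] (λ x → Σ[ ys ] (f x)) ≡ Σ[ ys ] (λ y → Σ[ xs ] (λ x → f x y))
Σ-swap []       ys f = sym (Σ-zero ys (λ _ → refl))
Σ-swap (x ∷ xs) ys f rewrite Σ-swap xs ys f =
  sym (Σ-+ ys (f x) (λ y → Σ[ xs ] (λ x → f x y)))

Σ-single : ∀ {xs : List A} {f : A → ℤ} {x₀} → Unique xs → x₀ ∈ xs →
           (∀ {x} → x ∈ xs → x ≢ x₀ → f x ≡ 0ℤ) → Σ[ xs ] f ≡ f x₀
Σ-single {xs = x ∷ xs} {f} (x∉xs ∷ _) (here refl) off =
  trans (cong (λ s → f x ℤ.+ s) (Σ-zero xs λ y∈xs → off (there y∈xs) (lookup x∉xs y∈xs ∘ sym)))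
        (ℤ.+-identityʳ (f x))
Σ-single {xs = x ∷ xs} (x∉xs ∷ unique) (there x₀∈xs) off =
  trans (cong₂ ℤ._+_ (off (here refl) (lookup x∉xs x₀∈xs)) (Σ-single unique x₀∈xs (off ∘ there)))
        (ℤ.+-identityˡ _)

-- The list is `tabulate g` for an arbitrary `g` because the induction passes from `g` to
-- `g ∘ Fin.suc`; `allFin n` is the case `g = id`.
Σ-telescope : ∀ n (g : Fin n → A) {f : A → ℤ} (ψ : Fin (suc n) → ℤ) →
              (∀ s → f (g s) ≡ ψ (Fin.inject₁ s) ℤ.- ψ (Fin.suc s)) →
              Σ[ tabulate g ] f ≡ ψ Fin.zero ℤ.- ψ (Fin.fromℕ n)
Σ-telescope zero    g ψ eq = sym (ℤ.+-inverseʳ (ψ Fin.zero))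
Σ-telescope (suc n) g {f} ψ eq =
  trans (cong₂ ℤ._+_ (eq Fin.zero) (Σ-telescope n (g ∘ Fin.suc) {f} (ψ ∘ Fin.suc) (eq ∘ Fin.suc)))
        (solve 3 (λ a b c → (a :- b) :+ (b :- c) := a :- c) refl
          (ψ Fin.zero) (ψ (Fin.suc Fin.zero)) (ψ (Fin.suc (Fin.fromℕ n))))

-- Indicators and the Kronecker delta

ind : Dec P → ℤ
ind P? = if does P? then 1ℤ else 0ℤ

ind-yes : (P? : Dec P) → P → ind P? ≡ 1ℤ
ind-yes P? holds = cong (if_then 1ℤ else 0ℤ) (dec-true P? holds)

ind-no : (P? : Dec P) → ¬ P → ind P? ≡ 0ℤ
ind-no P? fails = cong (if_then 1ℤ else 0ℤ) (dec-false P? fails)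

δ : Fin v → Fin v → ℤ
δ x y = ind (x Fin.≟ y)

δ-≡ : {x y : Fin v} → x ≡ y → δ x y ≡ 1ℤ
δ-≡ {x = x} {y} = ind-yes (x Fin.≟ y)

δ-≢ : {x y : Fin v} → x ≢ y → δ x y ≡ 0ℤ
δ-≢ {x = x} {y} = ind-no (x Fin.≟ y)

-- Summing over the blocks that contain a set thus becomes pairing with an indicator weight, the
-- form in which balance is proved.
Σ-filter : ∀ {P : Pred A p} (P? : Decidable P) (xs : List A) (f : A → ℤ) →
           Σ[ filter P? xs ] f ≡ Σ[ xs ] (λ x → ind (P? x) ℤ.* f x)
Σ-filter P? []       f = refl
Σ-filter P? (x ∷ xs) f with P? x
... | yes _ = cong₂ ℤ._+_ (sym (ℤ.*-identityˡ (f x))) (Σ-filter P? xs f)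
... | no  _ = trans (Σ-filter P? xs f) (sym (ℤ.+-identityˡ _))

-- Collections with values ±1 and the size of their legs

IsSign : ℤ → Set
IsSign i = i ≡ -1ℤ ⊎ i ≡ 1ℤ

IsSign-* : ∀ {i j} → IsSign i → IsSign j → IsSign (i ℤ.* j)
IsSign-* (inj₁ refl) (inj₁ refl) = inj₂ refl
IsSign-* (inj₁ refl) (inj₂ refl) = inj₁ refl
IsSign-* (inj₂ refl) (inj₁ refl) = inj₁ refl
IsSign-* (inj₂ refl) (inj₂ refl) = inj₂ refl

-- Each sign adds one to exactly one of the two legs, so the leg sums `m` and `m′` add up to the
-- length and differ by the total.
legs-of-signs : ∀ (xs : List A) (f : A → ℤ) → (∀ x → IsSign (f x)) →
  ∃ λ m → ∃ λ m′ → Σ[ xs ] (λ x → f x ⊔ 0ℤ) ≡ + m × Σ[ xs ] (λ x → (ℤ.- f x) ⊔ 0ℤ) ≡ + m′ ×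
    m + m′ ≡ length xs × Σ[ xs ] f ≡ + m ℤ.- + m′
legs-of-signs []       f sign = 0 , 0 , refl , refl , refl , refl
legs-of-signs (x ∷ xs) f sign with legs-of-signs xs f sign | sign x
... | m , m′ , eq₀ , eq₁ , len , total | inj₁ fx≡-1 rewrite fx≡-1 | eq₀ | eq₁ | total =
  m , suc m′ , refl , refl , trans (ℕ.+-suc m m′) (cong suc len) ,
  solve 2 (λ m m′ → con -1ℤ :+ (m :- m′) := m :- (con 1ℤ :+ m′)) refl (+ m) (+ m′)
... | m , m′ , eq₀ , eq₁ , len , total | inj₂ fx≡1 rewrite fx≡1 | eq₀ | eq₁ | total =
  suc m , m′ , refl , refl , cong suc len ,
  solve 2 (λ m m′ → con 1ℤ :+ (m :- m′) := (con 1ℤ :+ m) :- m′) refl (+ m) (+ m′)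

-- The list `blocks` is built by Pascal's rule.
length-blocks : ∀ v k → length (blocks v k) ≡ v choose k
length-blocks zero    zero    = refl
length-blocks zero    (suc k) = refl
length-blocks (suc v) zero    = trans (length-map without-0 (blocks v 0)) (length-blocks v 0)
length-blocks (suc v) (suc k)
  rewrite length-++ (map with-0 (blocks v k)) {map without-0 (blocks v (suc k))}
        | length-map (with-0 {v}) (blocks v k)
        | length-map (without-0 {v}) (blocks v (suc k))
        | length-blocks v k | length-blocks v (suc k) = nCk+nC[k+1]≡[n+1]C[k+1] v k

signs-volume : ∀ {v k} (f : Collection v k) → (∀ B → IsSign (f B)) → Σ[ blocks v k ] f ≡ 0ℤ →
               ∃ λ m → HasVolume f m × 2 * m ≡ v choose k
signs-volume {v} {k} f sign total with legs-of-signs (blocks v k) f sign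
... | m , m′ , eq₀ , eq₁ , len , total′
  -- Total zero forces the two legs to have the same size.
  with refl ← ℤ.+-injective {m} {m′} (ℤ.i-j≡0⇒i≡j (+ m) (+ m′) (trans (sym total′) total)) =
  m , (eq₀ , eq₁) ,
  -- `2 * m` unfolds to `m + (m + 0)`.
  trans (cong (m ℕ.+_) (ℕ.+-identityʳ m)) (trans len (length-blocks v k))

-- Small subsets

-- The very expression that `⟦ x , y , z ⟧` compares a block with, so no conversion between the two
-- is needed.
tri : Fin v → Fin v → Fin v → Subset v
tri x y z = ⁅ x ⁆ ∪ ⁅ y ⁆ ∪ ⁅ z ⁆

∈-tri⁻ : ∀ {u x y z : Fin v} → u ∈ˢ tri x y z → u ≡ x ⊎ u ≡ y ⊎ u ≡ z
∈-tri⁻ {x = x} {y} {z} u∈ with x∈p∪q⁻ ⁅ x ⁆ (⁅ y ⁆ ∪ ⁅ z ⁆) u∈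
... | inj₁ u∈x = inj₁ (x∈⁅y⁆⇒x≡y x u∈x)
... | inj₂ u∈yz with x∈p∪q⁻ ⁅ y ⁆ ⁅ z ⁆ u∈yz
...   | inj₁ u∈y = inj₂ (inj₁ (x∈⁅y⁆⇒x≡y y u∈y))
...   | inj₂ u∈z = inj₂ (inj₂ (x∈⁅y⁆⇒x≡y z u∈z))

∈-tri₁ : ∀ (x y z : Fin v) → x ∈ˢ tri x y z
∈-tri₁ x y z = x∈p∪q⁺ (inj₁ (x∈⁅x⁆ x))

∈-tri₂ : ∀ (x y z : Fin v) → y ∈ˢ tri x y z
∈-tri₂ x y z = x∈p∪q⁺ (inj₂ (x∈p∪q⁺ (inj₁ (x∈⁅x⁆ y))))

∈-tri₃ : ∀ (x y z : Fin v) → z ∈ˢ tri x y z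
∈-tri₃ x y z = x∈p∪q⁺ (inj₂ (x∈p∪q⁺ {p = ⁅ y ⁆} (inj₂ (x∈⁅x⁆ z))))

tri-swap₁₂ : ∀ (x y z : Fin v) → tri x y z ≡ tri y x z
tri-swap₁₂ x y z = trans (sym (∪-assoc ⁅ x ⁆ ⁅ y ⁆ ⁅ z ⁆))
  (trans (cong (_∪ ⁅ z ⁆) (∪-comm ⁅ x ⁆ ⁅ y ⁆)) (∪-assoc ⁅ y ⁆ ⁅ x ⁆ ⁅ z ⁆))

tri-swap₂₃ : ∀ (x y z : Fin v) → tri x y z ≡ tri x z y
tri-swap₂₃ x y z = cong (⁅ x ⁆ ∪_) (∪-comm ⁅ y ⁆ ⁅ z ⁆)

∣⁅x⁆∪S∣ : ∀ (x : Fin v) (S : Subset v) → x ∉ˢ S → ∣ ⁅ x ⁆ ∪ S ∣ ≡ suc ∣ S ∣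
∣⁅x⁆∪S∣ Fin.zero    (inside  Vec.∷ S) x∉S = contradiction Vec.here x∉S
∣⁅x⁆∪S∣ Fin.zero    (outside Vec.∷ S) x∉S = cong (suc ∘ ∣_∣) (∪-identityˡ S)
∣⁅x⁆∪S∣ (Fin.suc x) (inside  Vec.∷ S) x∉S = cong suc (∣⁅x⁆∪S∣ x S (x∉S ∘ Vec.there))
∣⁅x⁆∪S∣ (Fin.suc x) (outside Vec.∷ S) x∉S = ∣⁅x⁆∪S∣ x S (x∉S ∘ Vec.there)

record Distinct (x y z : Fin v) : Set where
  constructor distinct
  field
    x≢y : x ≢ y
    x≢z : x ≢ z
    y≢z : y ≢ z

<-distinct : ∀ {i j k : Fin N} → i Fin.< j → j Fin.< k → Distinct i j k
<-distinct i<j j<k = distinct (Fin.<⇒≢ i<j) (Fin.<⇒≢ (Fin.<-trans i<j j<k)) (Fin.<⇒≢ j<k)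

∣tri∣ : ∀ {x y z : Fin v} → Distinct x y z → ∣ tri x y z ∣ ≡ 3
∣tri∣ {x = x} {y} {z} (distinct x≢y x≢z y≢z) =
  trans (∣⁅x⁆∪S∣ x _ λ x∈ → [ x≢y ∘ x∈⁅y⁆⇒x≡y y , x≢z ∘ x∈⁅y⁆⇒x≡y z ]′ (x∈p∪q⁻ ⁅ y ⁆ ⁅ z ⁆ x∈))
        (cong suc (trans (∣⁅x⁆∪S∣ y _ (y≢z ∘ x∈⁅y⁆⇒x≡y z)) (cong suc (∣⁅x⁆∣≡1 z))))

pick : ∀ {k} (S : Subset v) → ∣ S ∣ ≡ suc k →
       ∃ λ x → ∃ λ S′ → x ∉ˢ S′ × ∣ S′ ∣ ≡ k × S ≡ ⁅ x ⁆ ∪ S′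
pick (inside Vec.∷ S) ∣S∣ =
  Fin.zero , outside Vec.∷ S , (λ ()) , ℕ.suc-injective ∣S∣ , cong (inside Vec.∷_) (sym (∪-identityˡ S))
pick (outside Vec.∷ S) ∣S∣ with pick S ∣S∣
... | x , S′ , x∉S′ , ∣S′∣ , eq =
  Fin.suc x , outside Vec.∷ S′ , (λ { (Vec.there x∈) → x∉S′ x∈ }) , ∣S′∣ , cong (outside Vec.∷_) eq

∣S∣≡0⇒S≡⊥ : ∀ (S : Subset v) → ∣ S ∣ ≡ 0 → S ≡ ⊥
∣S∣≡0⇒S≡⊥ Vec.[]            _   = refl
∣S∣≡0⇒S≡⊥ (outside Vec.∷ S) ∣S∣ = cong (outside Vec.∷_) (∣S∣≡0⇒S≡⊥ S ∣S∣)

singleton : (S : Subset v) → ∣ S ∣ ≡ 1 → ∃ λ x → S ≡ ⁅ x ⁆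
singleton S ∣S∣ with pick S ∣S∣
... | x , S′ , _ , ∣S′∣ , refl rewrite ∣S∣≡0⇒S≡⊥ S′ ∣S′∣ = x , ∪-identityʳ ⁅ x ⁆

doubleton : (S : Subset v) → ∣ S ∣ ≡ 2 → ∃ λ x → ∃ λ y → x ≢ y × S ≡ ⁅ x ⁆ ∪ ⁅ y ⁆
doubleton S ∣S∣ with pick S ∣S∣
... | x , S′ , x∉S′ , ∣S′∣ , refl with singleton S′ ∣S′∣
...   | y , refl = x , y , (λ { refl → x∉S′ (x∈⁅x⁆ y) }) , refl

tripleton : (S : Subset v) → ∣ S ∣ ≡ 3 → ∃ λ x → ∃ λ y → ∃ λ z → Distinct x y z × S ≡ tri x y z
tripleton S ∣S∣ with pick S ∣S∣
... | x , S′ , x∉S′ , ∣S′∣ , refl with doubleton S′ ∣S′∣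
...   | y , z , y≢z , refl =
  x , y , z ,
  distinct (λ { refl → x∉S′ (x∈p∪q⁺ (inj₁ (x∈⁅x⁆ y))) })
           (λ { refl → x∉S′ (x∈p∪q⁺ {p = ⁅ y ⁆} (inj₂ (x∈⁅x⁆ z))) }) y≢z , refl

-- Trilinear expansion of products

-- The product of collections with the block indicator replaced by any `F`: `(p · q · r) B` is
-- `prod p q r (λ x y z → ⟦ x , y , z ⟧ B)` by definition. One expansion then serves both evaluation
-- at a block and pairing with a weight.
prod : LinComb v → LinComb v → LinComb v → (Fin v → Fin v → Fin v → ℤ) → ℤ
prod p q r F =
  Σ[ p ] λ (c , x) → Σ[ q ] λ (d , y) → Σ[ r ] λ (e , z) → c ℤ.* d ℤ.* e ℤ.* F x y z

arrayValue : (x₀ x₁ x₂ y₀ y₁ y₂ : Fin v) → (Fin v → Fin v → Fin v → ℤ) → ℤ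
arrayValue x₀ x₁ x₂ y₀ y₁ y₂ = prod (pt x₀ ⊖ pt y₀) (pt x₁ ⊖ pt y₁) (pt x₂ ⊖ pt y₂)

-- The predicates carry what is known about the points of each factor, such as their index, so that
-- `F` and `G` have to agree only there.
prod-cong : ∀ (p q r : LinComb v) {P Q R : Fin v → Set} →
            All (P ∘ proj₂) p → All (Q ∘ proj₂) q → All (R ∘ proj₂) r →
            (F G : Fin v → Fin v → Fin v → ℤ) →
            (∀ {x y z} → P x → Q y → R z → F x y z ≡ G x y z) → prod p q r F ≡ prod p q r G
prod-cong p q r Ps Qs Rs F G eq =
  Σ-cong p λ {(c , x)} x∈ → Σ-cong q λ {(d , y)} y∈ → Σ-cong r λ {(e , z)} z∈ →
    cong (λ s → c ℤ.* d ℤ.* e ℤ.* s) (eq (lookup Ps x∈) (lookup Qs y∈) (lookup Rs z∈))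

-- Pairing collections with a weight on blocks

⟨_,_⟩ : (Subset v → ℤ) → Collection v 3 → ℤ
⟨ w , f ⟩ = Σ[ blocks _ 3 ] (λ B → w (proj₁ B) ℤ.* f B)

⟨⟩-+ : ∀ (w : Subset v → ℤ) f g → ⟨ w , f +ᶜ g ⟩ ≡ ⟨ w , f ⟩ ℤ.+ ⟨ w , g ⟩
⟨⟩-+ {v} w f g = trans (Σ-cong (blocks v 3) λ {B} _ → ℤ.*-distribˡ-+ (w (proj₁ B)) (f B) (g B))
                   (Σ-+ (blocks v 3) (λ B → w (proj₁ B) ℤ.* f B) (λ B → w (proj₁ B) ℤ.* g B))

⟨⟩-*ˡ : ∀ (w : Subset v → ℤ) c f → ⟨ w , (λ B → c ℤ.* f B) ⟩ ≡ c ℤ.* ⟨ w , f ⟩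
⟨⟩-*ˡ {v} w c f = trans
  (Σ-cong (blocks v 3) λ {B} _ →
    solve 3 (λ w c f → w :* (c :* f) := c :* (w :* f)) refl (w (proj₁ B)) c (f B))
  (Σ-*ˡ (blocks v 3) c (λ B → w (proj₁ B) ℤ.* f B))

⟨⟩-- : ∀ (w : Subset v → ℤ) f g → ⟨ w , f -ᶜ g ⟩ ≡ ⟨ w , f ⟩ ℤ.- ⟨ w , g ⟩
⟨⟩-- {v} w f g = trans (⟨⟩-+ w f (λ B → ℤ.- g B)) (cong (λ s → ⟨ w , f ⟩ ℤ.+ s)
  (trans (Σ-cong (blocks v 3) λ {B} _ → cong (w (proj₁ B) ℤ.*_) (sym (ℤ.-1*i≡-i (g B))))
         (trans (⟨⟩-*ˡ w -1ℤ g) (ℤ.-1*i≡-i ⟨ w , g ⟩))))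

⟨⟩-Σ : ∀ (w : Subset v → ℤ) (xs : List A) (F : A → Collection v 3) →
       ⟨ w , Σᶜ[ xs ] F ⟩ ≡ Σ[ xs ] (λ x → ⟨ w , F x ⟩)
⟨⟩-Σ {v} w xs F = trans (Σ-cong (blocks v 3) λ {B} _ → sym (Σ-*ˡ xs (w (proj₁ B)) (λ x → F x B)))
                    (Σ-swap (blocks v 3) xs (λ B x → w (proj₁ B) ℤ.* F x B))

⟨⟩-prod : ∀ (w : Subset v → ℤ) p q r → ⟨ w , p · q · r ⟩ ≡ prod p q r (λ x y z → ⟨ w , ⟦ x , y , z ⟧ ⟩)
⟨⟩-prod w p q r =
  trans (⟨⟩-Σ w p λ (c , x) B → Σ[ q ] λ (d , y) → Σ[ r ] λ (e , z) → c ℤ.* d ℤ.* e ℤ.* ⟦ x , y , z ⟧ B)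
    (Σ-cong p λ {(c , x)} _ →
      trans (⟨⟩-Σ w q λ (d , y) B → Σ[ r ] λ (e , z) → c ℤ.* d ℤ.* e ℤ.* ⟦ x , y , z ⟧ B)
        (Σ-cong q λ {(d , y)} _ →
          trans (⟨⟩-Σ w r λ (e , z) B → c ℤ.* d ℤ.* e ℤ.* ⟦ x , y , z ⟧ B)
            (Σ-cong r λ {(e , z)} _ → ⟨⟩-*ˡ w (c ℤ.* d ℤ.* e) ⟦ x , y , z ⟧)))

-- `⟦ x , y , z ⟧ B` unfolds to the `ind` of an equality test, so the lemmas on `ind` apply as they
-- are.
⟦⟧-yes : ∀ {x y z : Fin v} {B : Block v 3} → proj₁ B ≡ tri x y z → ⟦ x , y , z ⟧ B ≡ 1ℤ
⟦⟧-yes {x = x} {y} {z} {B} = ind-yes (≡-dec Bool._≟_ (proj₁ B) (tri x y z))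

⟦⟧-no : ∀ {x y z : Fin v} {B : Block v 3} → proj₁ B ≢ tri x y z → ⟦ x , y , z ⟧ B ≡ 0ℤ
⟦⟧-no {x = x} {y} {z} {B} = ind-no (≡-dec Bool._≟_ (proj₁ B) (tri x y z))

-- Distinctness makes `tri x y z` a block, and the list of blocks contains it exactly once.
⟨⟩-⟦⟧ : ∀ (w : Subset v → ℤ) {x y z} → Distinct x y z → ⟨ w , ⟦ x , y , z ⟧ ⟩ ≡ w (tri x y z)
⟨⟩-⟦⟧ {v} w {x} {y} {z} xyz =
  trans (Σ-single {x₀ = tri x y z , ∣tri∣ xyz} (blocks-unique v 3) (blocks-complete v 3 _)
          λ {B} _ B≢ → trans (cong (w (proj₁ B) ℤ.*_) (⟦⟧-no {B = B} (B≢ ∘ Block-≡)))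
                             (ℤ.*-zeroʳ (w (proj₁ B))))
        (trans (cong (w (tri x y z) ℤ.*_) (⟦⟧-yes {B = tri x y z , ∣tri∣ xyz} refl))
               (ℤ.*-identityʳ (w (tri x y z))))

-- Quadratic functions under arrays and edge terms

quadratic : (P Q : Fin v → ℤ) → Fin v → Fin v → Fin v → ℤ
quadratic P Q x y z = (P x ℤ.+ P y ℤ.+ P z) ℤ.* (Q x ℤ.+ Q y ℤ.+ Q z)

IsQuadratic : (Subset v → ℤ) → (P Q : Fin v → ℤ) → Set
IsQuadratic w P Q = ∀ {x y z} → Distinct x y z → w (tri x y z) ≡ quadratic P Q x y z

-- Each monomial of the expanded quadratic depends on at most two of the three arguments, so the two
-- choices in a remaining factor cancel.
arrayValue-quadratic : ∀ (P Q : Fin v → ℤ) x₀ x₁ x₂ y₀ y₁ y₂ →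
  arrayValue x₀ x₁ x₂ y₀ y₁ y₂ (quadratic P Q) ≡ 0ℤ
arrayValue-quadratic P Q x₀ x₁ x₂ y₀ y₁ y₂ =
  -- The left side copies the unfolded `prod` term by term, with its coefficients 1 and -1 and the
  -- trailing zeros of the sums, so that the solver's equation is the goal up to computation.
  solve 12 (λ a b c d e f a′ b′ c′ d′ e′ f′ →
    let m = λ p q r p′ q′ r′ → (p :+ q :+ r) :* (p′ :+ q′ :+ r′)
        pos = con 1ℤ :*_ ; neg = con -1ℤ :*_ ; o = con 0ℤ in
    ((pos (m a b c a′ b′ c′ ) :+ ( neg (m a b f a′ b′ f′) :+ o)) :+
     ((neg (m a e c a′ e′ c′) :+ (pos (m a e f a′ e′ f′ ) :+ o)) :+ o)) :+
    ((( neg (m d b c d′ b′ c′) :+ (pos (m d b f d′ b′ f′ ) :+ o)) :+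
     ((pos (m d e c d′ e′ c′) :+ ( neg (m d e f d′ e′ f′) :+ o)) :+ o)) :+ o)
    := o) refl
    (P x₀) (P x₁) (P x₂) (P y₀) (P y₁) (P y₂) (Q x₀) (Q x₁) (Q x₂) (Q y₀) (Q y₁) (Q y₂)

leg-expand : ∀ (x y z w : Fin v) F → prod (pt x) (pt y) (pt z ⊕ pt w) F ≡ F x y z ℤ.+ F x y w
leg-expand x y z w F =
  solve 2 (λ s t → (con 1ℤ :* s :+ (con 1ℤ :* t :+ con 0ℤ)) :+ con 0ℤ :+ con 0ℤ := s :+ t)
    refl (F x y z) (F x y w)

potential : (P Q : Fin v → ℤ) → Fin v → Fin v → ℤ
potential P Q x y =
  + 2 ℤ.* (P x ℤ.+ P y) ℤ.* (Q x ℤ.+ Q y) ℤ.- P x ℤ.* Q x ℤ.- P y ℤ.* Q y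

-- Write p, q for the sums of `P`, `Q` over x, y and p′, q′ for those over z, w. The first bracket
-- is 2pq + pq′ + p′q + P z Q z + P w Q w and the second is its mirror image; the mixed terms cancel
-- and the rest separates into the two potentials.
legs-quadratic : ∀ (P Q : Fin v → ℤ) x y z w →
  (quadratic P Q x y z ℤ.+ quadratic P Q x y w) ℤ.- (quadratic P Q z w x ℤ.+ quadratic P Q z w y) ≡
  potential P Q x y ℤ.- potential P Q z w
legs-quadratic P Q x y z w =
  solve 8 (λ px py pz pw qx qy qz qw →
    (px :+ py :+ pz) :* (qx :+ qy :+ qz) :+ (px :+ py :+ pw) :* (qx :+ qy :+ qw) :-
    ((pz :+ pw :+ px) :* (qz :+ qw :+ qx) :+ (pz :+ pw :+ py) :* (qz :+ qw :+ qy))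
    :=
    (con (+ 2) :* (px :+ py) :* (qx :+ qy) :- px :* qx :- py :* qy) :-
    (con (+ 2) :* (pz :+ pw) :* (qz :+ qw) :- pz :* qz :- pw :* qw)) refl
    (P x) (P y) (P z) (P w) (Q x) (Q y) (Q z) (Q w)

-- When the summand factors over its arguments, the array factors over its three columns.
arrayValue-product : ∀ (f g k : Fin v → ℤ) x₀ x₁ x₂ y₀ y₁ y₂ →
  arrayValue x₀ x₁ x₂ y₀ y₁ y₂ (λ x y z → f x ℤ.* g y ℤ.* k z) ≡
  (f x₀ ℤ.- f y₀) ℤ.* (g x₁ ℤ.- g y₁) ℤ.* (k x₂ ℤ.- k y₂)
arrayValue-product f g k x₀ x₁ x₂ y₀ y₁ y₂ =
  solve 6 (λ a b c d e f →
    let m = λ p q r → p :* q :* r ; pos = con 1ℤ :*_ ; neg = con -1ℤ :*_ ; o = con 0ℤ in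
    ((pos (m a b c) :+ (neg (m a b f) :+ o)) :+
     ((neg (m a e c) :+ (pos (m a e f) :+ o)) :+ o)) :+
    (((neg (m d b c) :+ (pos (m d b f) :+ o)) :+
     ((pos (m d e c) :+ (neg (m d e f) :+ o)) :+ o)) :+ o)
    := (a :- d) :* (b :- e) :* (c :- f)) refl
    (f x₀) (g x₁) (k x₂) (f y₀) (g y₁) (k y₂)

-- Increasing triples of indices

∈-triples⁺ : ∀ {i j k : Fin N} → i Fin.< j → j Fin.< k → (i , j , k) ∈ triples N
∈-triples⁺ {i = i} {j} {k} i<j j<k =
  ∈-filter⁺ _ (∈-cartesianProduct⁺ (∈-allFin i) (∈-cartesianProduct⁺ (∈-allFin j) (∈-allFin k)))
            (i<j , j<k)

∈-triples⁻ : ∀ {i j k : Fin N} → (i , j , k) ∈ triples N → i Fin.< j × j Fin.< k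
∈-triples⁻ {N} t∈ = proj₂ (∈-filter⁻ _ {xs = cartesianProduct (allFin N) (cartesianProduct (allFin N) (allFin N))} t∈)

triples-unique : ∀ N → Unique (triples N)
triples-unique N = Unique.filter⁺ _
  (Unique.cartesianProduct⁺ (Unique.allFin⁺ N) (Unique.cartesianProduct⁺ (Unique.allFin⁺ N) (Unique.allFin⁺ N)))

-- Decidability is what locates a vanishing factor; the negated conjunction alone does not name one.
product-zero : ∀ {X Y Z : Set} (X? : Dec X) (Y? : Dec Y) (Z? : Dec Z) {α β γ : ℤ} →
  (¬ X → α ≡ 0ℤ) → (¬ Y → β ≡ 0ℤ) → (¬ Z → γ ≡ 0ℤ) → ¬ (X × Y × Z) → α ℤ.* β ℤ.* γ ≡ 0ℤ
product-zero (no ¬x) _ _ {β = β} {γ} α≡0 _ _ _ rewrite α≡0 ¬x = refl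
product-zero (yes _) (no ¬y) _ {α} {γ = γ} _ β≡0 _ _ rewrite β≡0 ¬y | ℤ.*-zeroʳ α = refl
product-zero (yes _) (yes _) (no ¬z) {α} {β} _ _ γ≡0 _ rewrite γ≡0 ¬z = ℤ.*-zeroʳ (α ℤ.* β)
product-zero (yes x) (yes y) (yes z) _ _ _ ¬xyz = contradiction (x , y , z) ¬xyz

-- Points and the pairs that contain them

module Partitioned {a b : Fin N → Fin v} (partition : IsPartition a b) where
  open IsPartition partition

  -- The number of the pair that contains a given point.
  index : Fin v → Fin N
  index x = [ proj₁ , proj₁ ]′ (covers x)

  index-fibre : ∀ x → x ≡ a (index x) ⊎ x ≡ b (index x)
  index-fibre x with covers x
  ... | inj₁ (_ , eq) = inj₁ (sym eq)
  ... | inj₂ (_ , eq) = inj₂ (sym eq)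

  index-a : ∀ i → index (a i) ≡ i
  index-a i with index-fibre (a i)
  ... | inj₁ eq = sym (a-injective eq)
  ... | inj₂ eq = contradiction eq (disjoint i _)

  index-b : ∀ i → index (b i) ≡ i
  index-b i with index-fibre (b i)
  ... | inj₁ eq = contradiction (sym eq) (disjoint _ i)
  ... | inj₂ eq = sym (b-injective eq)

  diff sum : Fin N → LinComb v
  diff i = pt (a i) ⊖ pt (b i)
  sum  i = pt (a i) ⊕ pt (b i)

  pair-index : ∀ i {c d : ℤ} → All ((λ x → index x ≡ i) ∘ proj₂) ((c , a i) ∷ (d , b i) ∷ [])
  pair-index i = index-a i ∷ index-b i ∷ []

  index-distinct : ∀ {x y z i j k} → Distinct i j k → index x ≡ i → index y ≡ j → index z ≡ k →
                   Distinct x y z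
  index-distinct (distinct i≢j i≢k j≢k) refl refl refl =
    distinct (i≢j ∘ cong index) (i≢k ∘ cong index) (j≢k ∘ cong index)

  a≢b : ∀ i → a i ≢ b i
  a≢b i = disjoint i i

  pair-distinct : ∀ {i j z} → i ≢ j → index z ≡ j → Distinct (a i) (b i) z
  pair-distinct {i} i≢j refl = distinct (a≢b i)
    (λ eq → i≢j (trans (sym (index-a i)) (cong index eq)))
    (λ eq → i≢j (trans (sym (index-b i)) (cong index eq)))

  arrayAt : Fin N × Fin N × Fin N → Collection v 3
  arrayAt (i , j , k) = array (a i) (a j) (a k) (b i) (b j) (b k)

  -- Restates the summand of `T`, which is local to the definition of `T`; the two agree by
  -- unfolding.
  edge : Fin N → Fin N → Collection v 3
  edge i j = (pt (a i) · pt (b i) · sum j) -ᶜ (pt (a j) · pt (b j) · sum i)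

  array-cong : ∀ i j k (F G : Fin v → Fin v → Fin v → ℤ) →
    (∀ {x y z} → index x ≡ i → index y ≡ j → index z ≡ k → F x y z ≡ G x y z) →
    prod (diff i) (diff j) (diff k) F ≡ prod (diff i) (diff j) (diff k) G
  array-cong i j k = prod-cong (diff i) (diff j) (diff k) (pair-index i) (pair-index j) (pair-index k)

  -- Quadratic weights pair to zero with `h`

  module _ (w : Subset v → ℤ) (P Q : Fin v → ℤ) (w-quadratic : IsQuadratic w P Q) where

    -- Points from three different pairs are distinct, so all eight terms are genuine blocks and the
    -- weight may be replaced by its quadratic form.
    ⟨⟩-array : ∀ {i j k} → Distinct i j k → ⟨ w , arrayAt (i , j , k) ⟩ ≡ 0ℤ
    ⟨⟩-array {i} {j} {k} ijk = begin
      ⟨ w , arrayAt (i , j , k) ⟩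
        ≡⟨ ⟨⟩-prod w (diff i) (diff j) (diff k) ⟩
      prod (diff i) (diff j) (diff k) (λ x y z → ⟨ w , ⟦ x , y , z ⟧ ⟩)
        ≡⟨ array-cong i j k _ (quadratic P Q) (λ xi yj zk →
             let xyz = index-distinct ijk xi yj zk in trans (⟨⟩-⟦⟧ w xyz) (w-quadratic xyz)) ⟩
      prod (diff i) (diff j) (diff k) (quadratic P Q)
        ≡⟨ arrayValue-quadratic P Q (a i) (a j) (a k) (b i) (b j) (b k) ⟩
      0ℤ ∎

    ⟨⟩-leg : ∀ {i j} → i ≢ j → ⟨ w , pt (a i) · pt (b i) · sum j ⟩ ≡
             quadratic P Q (a i) (b i) (a j) ℤ.+ quadratic P Q (a i) (b i) (b j)
    ⟨⟩-leg {i} {j} i≢j = begin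
      ⟨ w , pt (a i) · pt (b i) · sum j ⟩
        ≡⟨ ⟨⟩-prod w (pt (a i)) (pt (b i)) (sum j) ⟩
      prod (pt (a i)) (pt (b i)) (sum j) (λ x y z → ⟨ w , ⟦ x , y , z ⟧ ⟩)
        ≡⟨ leg-expand (a i) (b i) (a j) (b j) (λ x y z → ⟨ w , ⟦ x , y , z ⟧ ⟩) ⟩
      ⟨ w , ⟦ a i , b i , a j ⟧ ⟩ ℤ.+ ⟨ w , ⟦ a i , b i , b j ⟧ ⟩
        ≡⟨ cong₂ ℤ._+_ (at (pair-distinct i≢j (index-a j))) (at (pair-distinct i≢j (index-b j))) ⟩
      quadratic P Q (a i) (b i) (a j) ℤ.+ quadratic P Q (a i) (b i) (b j) ∎
      where
      at : ∀ {x y z} → Distinct x y z → ⟨ w , ⟦ x , y , z ⟧ ⟩ ≡ quadratic P Q x y z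
      at xyz = trans (⟨⟩-⟦⟧ w xyz) (w-quadratic xyz)

    ⟨⟩-edge : ∀ {i j} → i ≢ j →
              ⟨ w , edge i j ⟩ ≡ potential P Q (a i) (b i) ℤ.- potential P Q (a j) (b j)
    ⟨⟩-edge {i} {j} i≢j = begin
      ⟨ w , edge i j ⟩
        ≡⟨ ⟨⟩-- w (pt (a i) · pt (b i) · sum j) (pt (a j) · pt (b j) · sum i) ⟩
      _ ≡⟨ cong₂ ℤ._-_ (⟨⟩-leg i≢j) (⟨⟩-leg (i≢j ∘ sym)) ⟩
      _ ≡⟨ legs-quadratic P Q (a i) (b i) (a j) (b j) ⟩
      potential P Q (a i) (b i) ℤ.- potential P Q (a j) (b j) ∎

    -- Each step contributes the potential of its source minus that of its target; the sum collapses
    -- to the two ends of the walk, which coincide.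
    ⟨⟩-T : ∀ {G : Graph N} (W : ClosedWalk G) → ⟨ w , T a b W ⟩ ≡ 0ℤ
    ⟨⟩-T {G} W = begin
      ⟨ w , T a b W ⟩
        ≡⟨ ⟨⟩-Σ w (allFin len) (λ s → edge (src s) (tgt s)) ⟩
      Σ[ allFin len ] (λ s → ⟨ w , edge (src s) (tgt s) ⟩)
        ≡⟨ Σ-telescope len id φ (λ s → ⟨⟩-edge (src≢tgt s)) ⟩
      φ Fin.zero ℤ.- φ (Fin.fromℕ len)
        ≡⟨ ℤ.i≡j⇒i-j≡0 {φ Fin.zero}
             (cong (λ i → potential P Q (a i) (b i)) (sym closed)) ⟩
      0ℤ ∎
      where
      open ClosedWalk W
      φ : Fin (suc len) → ℤ
      φ s = potential P Q (a (vertex s)) (b (vertex s))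
      -- A step that stays in place would contradict the irreflexivity of `G`.
      src≢tgt : ∀ s → src s ≢ tgt s
      src≢tgt s eq = Graph.irrefl G (subst (Graph.Adj G (src s)) (sym eq) (step s))

    ⟨⟩-h : ∀ {G : Graph N} (W : ClosedWalk G) → ⟨ w , h a b W ⟩ ≡ 0ℤ
    ⟨⟩-h W = begin
      ⟨ w , h a b W ⟩
        ≡⟨ ⟨⟩-+ w (Σᶜ[ triples N ] arrayAt) (T a b W) ⟩
      ⟨ w , Σᶜ[ triples N ] arrayAt ⟩ ℤ.+ ⟨ w , T a b W ⟩
        ≡⟨ cong₂ ℤ._+_ (⟨⟩-Σ w (triples N) arrayAt) (⟨⟩-T W) ⟩
      Σ[ triples N ] (λ t → ⟨ w , arrayAt t ⟩) ℤ.+ 0ℤ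
        ≡⟨ cong (λ s → s ℤ.+ 0ℤ) (Σ-zero (triples N) λ {(i , j , k)} t∈ →
             let i<j = proj₁ (∈-triples⁻ t∈) ; j<k = proj₂ (∈-triples⁻ t∈) in
             ⟨⟩-array (<-distinct i<j j<k)) ⟩
      0ℤ ∎

  -- Evaluating h at a block

  -- A pair holds only two points, so a block either meets three pairs or consists of one pair and a
  -- point of another. A transversal is listed by increasing index, the order used by `triples`.
  data Shape (S : Subset v) : Set where
    transversal : ∀ x y z → index x Fin.< index y → index y Fin.< index z → S ≡ tri x y z → Shape S
    paired      : ∀ i z → i ≢ index z → S ≡ tri (a i) (b i) z → Shape S

  shape-paired : ∀ {x y z} → Distinct x y z → index x ≡ index y → Shape (tri x y z)
  shape-paired {x} {y} {z} (distinct x≢y x≢z y≢z) ix≡iy with index-fibre x | index-fibre y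
  -- Two distinct points of one pair must be its `a` and its `b`.
  ... | inj₁ x≡a | inj₁ y≡a = contradiction (trans x≡a (trans (cong a ix≡iy) (sym y≡a))) x≢y
  ... | inj₂ x≡b | inj₂ y≡b = contradiction (trans x≡b (trans (cong b ix≡iy) (sym y≡b))) x≢y
  ... | inj₁ x≡a | inj₂ y≡b = paired (index x) z ix≢iz (cong₂ (λ x y → tri x y z) x≡a y≡b′)
    where
    y≡b′ : y ≡ b (index x)
    y≡b′ = trans y≡b (cong b (sym ix≡iy))
    ix≢iz : index x ≢ index z
    -- A third point of the same pair would repeat one of the two.
    ix≢iz ix≡iz with index-fibre z
    ... | inj₁ z≡a = x≢z (trans x≡a (trans (cong a ix≡iz) (sym z≡a)))
    ... | inj₂ z≡b = y≢z (trans y≡b′ (trans (cong b ix≡iz) (sym z≡b)))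
  ... | inj₂ x≡b | inj₁ y≡a =
    paired (index x) z ix≢iz (trans (tri-swap₁₂ x y z) (cong₂ (λ x y → tri x y z) y≡a′ x≡b))
    where
    y≡a′ : y ≡ a (index x)
    y≡a′ = trans y≡a (cong a (sym ix≡iy))
    ix≢iz : index x ≢ index z
    ix≢iz ix≡iz with index-fibre z
    ... | inj₁ z≡a = y≢z (trans y≡a′ (trans (cong a ix≡iz) (sym z≡a)))
    ... | inj₂ z≡b = x≢z (trans x≡b (trans (cong b ix≡iz) (sym z≡b)))

  shape-paired₁₃ : ∀ {x y z} → Distinct x y z → index x ≡ index z → Shape (tri x y z)
  shape-paired₁₃ {x} {y} {z} (distinct x≢y x≢z y≢z) ix≡iz =
    subst Shape (tri-swap₂₃ x z y) (shape-paired (distinct x≢z x≢y (y≢z ∘ sym)) ix≡iz)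

  shape-paired₂₃ : ∀ {x y z} → Distinct x y z → index y ≡ index z → Shape (tri x y z)
  shape-paired₂₃ {x} {y} {z} (distinct x≢y x≢z y≢z) iy≡iz =
    subst Shape (tri-swap₁₂ y x z) (shape-paired₁₃ (distinct (x≢y ∘ sym) y≢z x≢z) iy≡iz)

  shape : ∀ {x y z} → Distinct x y z → Shape (tri x y z)
  shape {x} {y} {z} xyz
    with Fin.<-cmp (index x) (index y) | Fin.<-cmp (index y) (index z) | Fin.<-cmp (index x) (index z)
  ... | tri≈ _ x≈y _ | _            | _            = shape-paired xyz x≈y
  ... | tri< _ _ _   | tri≈ _ y≈z _ | _            = shape-paired₂₃ xyz y≈z
  ... | tri> _ _ _   | tri≈ _ y≈z _ | _            = shape-paired₂₃ xyz y≈z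
  ... | tri< _ _ _   | tri> _ _ _   | tri≈ _ x≈z _ = shape-paired₁₃ xyz x≈z
  ... | tri> _ _ _   | tri< _ _ _   | tri≈ _ x≈z _ = shape-paired₁₃ xyz x≈z
  -- From here on the three indices differ, and only their order remains to be sorted.
  ... | tri< x<y _ _ | tri< y<z _ _ | _ = transversal x y z x<y y<z refl
  ... | tri< x<y _ _ | tri> _ _ z<y | tri< x<z _ _ = transversal x z y x<z z<y (tri-swap₂₃ x y z)
  ... | tri< x<y _ _ | tri> _ _ z<y | tri> _ _ z<x =
    transversal z x y z<x x<y (trans (tri-swap₂₃ x y z) (tri-swap₁₂ x z y))
  ... | tri> _ _ y<x | tri< y<z _ _ | tri< x<z _ _ = transversal y x z y<x x<z (tri-swap₁₂ x y z)
  ... | tri> _ _ y<x | tri< y<z _ _ | tri> _ _ z<x =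
    transversal y z x y<z z<x (trans (tri-swap₁₂ x y z) (tri-swap₂₃ y x z))
  ... | tri> _ _ y<x | tri> _ _ z<y | _ =
    transversal z y x z<y y<x
      (trans (tri-swap₁₂ x y z) (trans (tri-swap₂₃ y x z) (tri-swap₁₂ y z x)))

  -- Value of `h` at blocks that meet three pairs

  transversal-injective : ∀ {x y z u u′} → Distinct (index x) (index y) (index z) →
    u ∈ˢ tri x y z → u′ ∈ˢ tri x y z → index u ≡ index u′ → u ≡ u′
  transversal-injective (distinct x≢y x≢z y≢z) u∈ u′∈ eq with ∈-tri⁻ u∈ | ∈-tri⁻ u′∈
  ... | inj₁ refl        | inj₁ refl        = refl
  ... | inj₁ refl        | inj₂ (inj₁ refl) = contradiction eq x≢y
  ... | inj₁ refl        | inj₂ (inj₂ refl) = contradiction eq x≢z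
  ... | inj₂ (inj₁ refl) | inj₁ refl        = contradiction (sym eq) x≢y
  ... | inj₂ (inj₁ refl) | inj₂ (inj₁ refl) = refl
  ... | inj₂ (inj₁ refl) | inj₂ (inj₂ refl) = contradiction eq y≢z
  ... | inj₂ (inj₂ refl) | inj₁ refl        = contradiction (sym eq) x≢z
  ... | inj₂ (inj₂ refl) | inj₂ (inj₁ refl) = contradiction (sym eq) y≢z
  ... | inj₂ (inj₂ refl) | inj₂ (inj₂ refl) = refl

  -- `a i` and `b i` have the same index, which two different points of a transversal set cannot
  -- have.
  transversal≢paired : ∀ {x y z i u} → Distinct (index x) (index y) (index z) →
                       tri x y z ≢ tri (a i) (b i) u
  transversal≢paired {i = i} {u} xyz eq = a≢b i (transversal-injective xyz
    (subst (a i ∈ˢ_) (sym eq) (∈-tri₁ (a i) (b i) u))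
    (subst (b i ∈ˢ_) (sym eq) (∈-tri₂ (a i) (b i) u))
    (trans (index-a i) (sym (index-b i))))

  Sorted : Fin v → Fin v → Fin v → Set
  Sorted x y z = index x Fin.< index y × index y Fin.< index z

  sorted-min : ∀ {x y z u} → Sorted x y z → u ∈ˢ tri x y z → index x Fin.≤ index u
  sorted-min (x<y , y<z) u∈ with ∈-tri⁻ u∈
  ... | inj₁ refl        = ℕ.≤-refl
  ... | inj₂ (inj₁ refl) = ℕ.<⇒≤ x<y
  ... | inj₂ (inj₂ refl) = ℕ.<⇒≤ (ℕ.<-trans x<y y<z)

  sorted-max : ∀ {x y z u} → Sorted x y z → u ∈ˢ tri x y z → index u Fin.≤ index z
  sorted-max (x<y , y<z) u∈ with ∈-tri⁻ u∈
  ... | inj₁ refl        = ℕ.<⇒≤ (ℕ.<-trans x<y y<z)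
  ... | inj₂ (inj₁ refl) = ℕ.<⇒≤ y<z
  ... | inj₂ (inj₂ refl) = ℕ.≤-refl

  -- The extreme indices are intrinsic to the set, and a transversal set has at most one point per
  -- index. This matches the first and last points; the middle one is what is left.
  tri-injective : ∀ {x y z x′ y′ z′} → Sorted x y z → Sorted x′ y′ z′ → tri x y z ≡ tri x′ y′ z′ →
                  x ≡ x′ × y ≡ y′ × z ≡ z′
  tri-injective {x} {y} {z} {x′} {y′} {z′} s@(x<y , y<z) s′@(x′<y′ , y′<z′) eq = x≡x′ , y≡y′ , z≡z′
    where
    to : ∀ {u} → u ∈ˢ tri x y z → u ∈ˢ tri x′ y′ z′
    to {u} = subst (u ∈ˢ_) eq
    from : ∀ {u} → u ∈ˢ tri x′ y′ z′ → u ∈ˢ tri x y z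
    from {u} = subst (u ∈ˢ_) (sym eq)
    x≡x′ : x ≡ x′
    x≡x′ = transversal-injective (<-distinct x<y y<z) (∈-tri₁ x y z) (from (∈-tri₁ x′ y′ z′))
      (Fin.≤-antisym (sorted-min s (from (∈-tri₁ x′ y′ z′))) (sorted-min s′ (to (∈-tri₁ x y z))))
    z≡z′ : z ≡ z′
    z≡z′ = transversal-injective (<-distinct x<y y<z) (∈-tri₃ x y z) (from (∈-tri₃ x′ y′ z′))
      (Fin.≤-antisym (sorted-max s′ (to (∈-tri₃ x y z))) (sorted-max s (from (∈-tri₃ x′ y′ z′))))
    y≡y′ : y ≡ y′
    y≡y′ with ∈-tri⁻ (to (∈-tri₂ x y z))
    ... | inj₁ y≡x′        = contradiction (cong index (trans x≡x′ (sym y≡x′))) (Fin.<⇒≢ x<y)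
    ... | inj₂ (inj₁ y≡y′) = y≡y′
    ... | inj₂ (inj₂ y≡z′) = contradiction (cong index (trans y≡z′ (sym z≡z′))) (Fin.<⇒≢ y<z)

  -- The product of deltas separates the three points, which is the form that `arrayValue-product`
  -- factors.
  ⟦⟧-transversal : ∀ {x y z x′ y′ z′} (B : Block v 3) → Sorted x y z → Sorted x′ y′ z′ →
    proj₁ B ≡ tri x′ y′ z′ → ⟦ x , y , z ⟧ B ≡ δ x x′ ℤ.* δ y y′ ℤ.* δ z z′
  ⟦⟧-transversal {x} {y} {z} {x′} {y′} {z′} B s s′ B≡ with ≡-dec Bool._≟_ (proj₁ B) (tri x y z)
  ... | no B≢ = sym (product-zero (x Fin.≟ x′) (y Fin.≟ y′) (z Fin.≟ z′) δ-≢ δ-≢ δ-≢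
                       λ { (refl , refl , refl) → B≢ B≡ })
  ... | yes B≡′ with tri-injective s s′ (trans (sym B≡′) B≡)
  ...   | refl , refl , refl rewrite δ-≡ {x = x} refl | δ-≡ {x = y} refl | δ-≡ {x = z} refl = refl

  -- The coefficient of `x` in the formal difference of `a i` and `b i`.
  signAt : Fin v → Fin N → ℤ
  signAt x i = δ (a i) x ℤ.- δ (b i) x

  signAt-≢ : ∀ {x i} → i ≢ index x → signAt x i ≡ 0ℤ
  signAt-≢ {x} {i} i≢
    rewrite δ-≢ {x = a i} {x} (λ { refl → i≢ (sym (index-a i)) })
          | δ-≢ {x = b i} {x} (λ { refl → i≢ (sym (index-b i)) }) = refl

  signAt-index : ∀ x → IsSign (signAt x (index x))
  signAt-index x with index-fibre x
  ... | inj₁ x≡a rewrite δ-≡ (sym x≡a) | δ-≢ {x = b (index x)} {x} (λ b≡x → a≢b _ (sym (trans b≡x x≡a))) =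
    inj₂ refl
  ... | inj₂ x≡b rewrite δ-≡ (sym x≡b) | δ-≢ {x = a (index x)} {x} (λ a≡x → a≢b _ (trans a≡x x≡b)) =
    inj₁ refl

  module _ {x y z : Fin v} (s : Sorted x y z) (B : Block v 3) (B≡ : proj₁ B ≡ tri x y z) where

    private
      x<y = proj₁ s
      y<z = proj₂ s

    signProduct : Fin N × Fin N × Fin N → ℤ
    signProduct (i , j , k) = signAt x i ℤ.* signAt y j ℤ.* signAt z k

    array-transversal : ∀ {i j k} → i Fin.< j → j Fin.< k → arrayAt (i , j , k) B ≡ signProduct (i , j , k)
    array-transversal {i} {j} {k} i<j j<k = trans
      (array-cong i j k (λ x y z → ⟦ x , y , z ⟧ B) (λ x′ y′ z′ → δ x′ x ℤ.* δ y′ y ℤ.* δ z′ z)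
        (λ { refl refl refl → ⟦⟧-transversal B (i<j , j<k) s B≡ }))
      (arrayValue-product (λ x′ → δ x′ x) (λ y′ → δ y′ y) (λ z′ → δ z′ z)
        (a i) (a j) (a k) (b i) (b j) (b k))

    arrays-transversal : Σ[ triples N ] (λ t → arrayAt t B) ≡ signProduct (index x , index y , index z)
    arrays-transversal = trans
      (Σ-cong (triples N) λ t∈ → let ijk = ∈-triples⁻ t∈ in array-transversal (proj₁ ijk) (proj₂ ijk))
      -- Any other triple differs from the indices of the block in some place, where its `signAt`
      -- vanishes.
      (Σ-single (triples-unique N) (∈-triples⁺ x<y y<z) λ {(i , j , k)} _ t≢ →
        product-zero (i Fin.≟ index x) (j Fin.≟ index y) (k Fin.≟ index z)
          signAt-≢ signAt-≢ signAt-≢ λ { (refl , refl , refl) → t≢ refl })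

    leg-transversal : ∀ i j → (pt (a i) · pt (b i) · sum j) B ≡ 0ℤ
    leg-transversal i j = trans (leg-expand (a i) (b i) (a j) (b j) (λ x y z → ⟦ x , y , z ⟧ B))
      (cong₂ ℤ._+_ (⟦⟧-no {B = B} B≢) (⟦⟧-no {B = B} B≢))
      where
      B≢ : ∀ {u} → proj₁ B ≢ tri (a i) (b i) u
      B≢ eq = transversal≢paired (<-distinct x<y y<z) (trans (sym B≡) eq)

    h-transversal : ∀ {G : Graph N} (W : ClosedWalk G) → IsSign (h a b W B)
    h-transversal W = subst IsSign (sym eq)
      (IsSign-* (IsSign-* (signAt-index x) (signAt-index y)) (signAt-index z))
      where
      open ClosedWalk W
      eq : h a b W B ≡ signProduct (index x , index y , index z)
      eq = trans (cong₂ ℤ._+_ arrays-transversal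
             (Σ-zero (allFin len) λ {s} _ →
               cong₂ ℤ._-_ (leg-transversal (src s) (tgt s)) (leg-transversal (tgt s) (src s))))
             (ℤ.+-identityʳ _)

  -- Value of `h` at blocks that contain a pair

  -- Of `a i` and `b i` at most one can be the third point `z`; the other lies in the pair numbered
  -- `j`.
  pair∈paired : ∀ {i j z} → a i ∈ˢ tri (a j) (b j) z → b i ∈ˢ tri (a j) (b j) z → i ≡ j
  pair∈paired {i} {j} a∈ b∈ with ∈-tri⁻ a∈ | ∈-tri⁻ b∈
  ... | inj₁ a≡a         | _                = a-injective a≡a
  ... | inj₂ (inj₁ a≡b)  | _                = contradiction a≡b (disjoint i j)
  ... | inj₂ (inj₂ _)    | inj₁ b≡a         = contradiction (sym b≡a) (disjoint j i)
  ... | inj₂ (inj₂ _)    | inj₂ (inj₁ b≡b)  = b-injective b≡b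
  ... | inj₂ (inj₂ refl) | inj₂ (inj₂ b≡a)  = contradiction (sym b≡a) (a≢b i)

  -- By `pair∈paired` the block determines its pair; `j ≢ index u` keeps `u` out of that pair, so
  -- `u` must be the third point.
  ⟦⟧-paired : ∀ {i z j u} (B : Block v 3) → proj₁ B ≡ tri (a i) (b i) z → j ≢ index u →
              ⟦ a j , b j , u ⟧ B ≡ δ j i ℤ.* δ u z
  ⟦⟧-paired {i} {z} {j} {u} B B≡ j≢ with j Fin.≟ i | u Fin.≟ z
  ... | no j≢i | _ = ⟦⟧-no {B = B} λ B≡′ → let eq = trans (sym B≡′) B≡ in
    j≢i (pair∈paired (subst (a j ∈ˢ_) eq (∈-tri₁ (a j) (b j) u)) (subst (b j ∈ˢ_) eq (∈-tri₂ (a j) (b j) u)))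
  ... | yes refl | yes refl = ⟦⟧-yes {B = B} B≡
  ... | yes refl | no u≢z = ⟦⟧-no {B = B} λ B≡′ →
    [ (λ { refl → j≢ (sym (index-a j)) })
    , [ (λ { refl → j≢ (sym (index-b j)) }) , u≢z ]′ ]′
    (∈-tri⁻ (subst (u ∈ˢ_) (trans (sym B≡′) B≡) (∈-tri₃ (a j) (b j) u)))

  -- Exactly one point of the pair numbered `index z` is `z`, so the sum over a pair sees only the
  -- index of `z`.
  δ-sum : ∀ j z → δ (a j) z ℤ.+ δ (b j) z ≡ δ j (index z)
  δ-sum j z with j Fin.≟ index z
  ... | no j≢
    rewrite δ-≢ {x = a j} {z} (λ { refl → j≢ (sym (index-a j)) })
          | δ-≢ {x = b j} {z} (λ { refl → j≢ (sym (index-b j)) }) = refl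
  ... | yes refl with index-fibre z
  ...   | inj₁ z≡a rewrite δ-≡ (sym z≡a) | δ-≢ {x = b (index z)} {z} (λ b≡z → a≢b _ (sym (trans b≡z z≡a))) = refl
  ...   | inj₂ z≡b rewrite δ-≡ (sym z≡b) | δ-≢ {x = a (index z)} {z} (λ a≡z → a≢b _ (trans a≡z z≡b)) = refl

  module _ {i : Fin N} {z : Fin v} (i≢iz : i ≢ index z) (B : Block v 3) (B≡ : proj₁ B ≡ tri (a i) (b i) z) where

    array-paired : ∀ {j k l} → j Fin.< k → k Fin.< l → arrayAt (j , k , l) B ≡ 0ℤ
    array-paired {j} {k} {l} j<k k<l =
      array-cong j k l (λ x y z → ⟦ x , y , z ⟧ B) (λ _ _ _ → 0ℤ) λ { refl refl refl →
        ⟦⟧-no {B = B} λ B≡′ → transversal≢paired (<-distinct j<k k<l) (trans (sym B≡′) B≡) }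

    leg-paired : ∀ {j k} → j ≢ k → (pt (a j) · pt (b j) · sum k) B ≡ δ j i ℤ.* δ k (index z)
    leg-paired {j} {k} j≢k = begin
      (pt (a j) · pt (b j) · sum k) B
        ≡⟨ leg-expand (a j) (b j) (a k) (b k) (λ x y z → ⟦ x , y , z ⟧ B) ⟩
      ⟦ a j , b j , a k ⟧ B ℤ.+ ⟦ a j , b j , b k ⟧ B
        ≡⟨ cong₂ ℤ._+_ (⟦⟧-paired B B≡ (λ eq → j≢k (trans eq (index-a k))))
                       (⟦⟧-paired B B≡ (λ eq → j≢k (trans eq (index-b k)))) ⟩
      δ j i ℤ.* δ (a k) z ℤ.+ δ j i ℤ.* δ (b k) z
        ≡⟨ ℤ.*-distribˡ-+ (δ j i) (δ (a k) z) (δ (b k) z) ⟨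
      δ j i ℤ.* (δ (a k) z ℤ.+ δ (b k) z)
        ≡⟨ cong (δ j i ℤ.*_) (δ-sum k z) ⟩
      δ j i ℤ.* δ k (index z) ∎

    edge-paired : ∀ {j k} → j ≢ k →
      edge j k B ≡ δ j i ℤ.* δ k (index z) ℤ.- δ k i ℤ.* δ j (index z)
    edge-paired j≢k = cong₂ ℤ._-_ (leg-paired j≢k) (leg-paired (j≢k ∘ sym))

    h-paired : (W : ClosedWalk (complete N)) → IsEulerian W → IsSign (h a b W B)
    -- The block corresponds to the edge between `i` and `index z`, which exactly one step `s₀`
    -- traverses.
    h-paired W eulerian with eulerian i (index z) i≢iz
    ... | s₀ , traverses , unique = subst IsSign (sym h≡) (sign traverses)
      where
      open ClosedWalk W

      contribution : Fin len → ℤ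
      contribution s = δ (src s) i ℤ.* δ (tgt s) (index z) ℤ.- δ (tgt s) i ℤ.* δ (src s) (index z)

      δδ-zero : ∀ {j k j′ k′ : Fin N} → ¬ (j ≡ j′ × k ≡ k′) → δ j j′ ℤ.* δ k k′ ≡ 0ℤ
      δδ-zero {j} {k} {j′} {k′} ¬eq with j Fin.≟ j′ | k Fin.≟ k′
      ... | no _     | _        = refl
      ... | yes _    | no _     = refl
      ... | yes refl | yes refl = contradiction (refl , refl) ¬eq

      off : ∀ {s} → s ≢ s₀ → contribution s ≡ 0ℤ
      -- A nonzero product would make `s` a traversal of that edge, in one of the two directions.
      off s≢s₀ = cong₂ ℤ._-_
        (δδ-zero λ (eq , eq′) → s≢s₀ (sym (unique (inj₁ (eq , eq′)))))
        (δδ-zero λ (eq , eq′) → s≢s₀ (sym (unique (inj₂ (eq′ , eq)))))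

      -- The direction in which the walk takes the edge decides the sign; the product for the
      -- opposite direction is zero because `i ≢ index z`.
      sign : Traverses s₀ i (index z) → IsSign (contribution s₀)
      sign (inj₁ (refl , tgt≡))
        rewrite tgt≡ | δ-≡ {x = src s₀} refl | δ-≡ {x = index z} refl | δ-≢ i≢iz
              | δ-≢ (i≢iz ∘ sym) = inj₂ refl
      sign (inj₂ (src≡ , refl))
        rewrite src≡ | δ-≡ {x = tgt s₀} refl | δ-≡ {x = index z} refl | δ-≢ i≢iz
              | δ-≢ (i≢iz ∘ sym) = inj₁ refl

      h≡ : h a b W B ≡ contribution s₀
      h≡ = trans
        (cong₂ ℤ._+_
          (Σ-zero (triples N) λ t∈ → let jkl = ∈-triples⁻ t∈ in array-paired (proj₁ jkl) (proj₂ jkl))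
          (trans (Σ-cong (allFin len) λ {s} _ → edge-paired (step s))
                 (Σ-single (Unique.allFin⁺ len) (∈-allFin s₀) λ _ → off)))
        (ℤ.+-identityˡ _)

  h-sign : (W : ClosedWalk (complete N)) → IsEulerian W → ∀ B → IsSign (h a b W B)
  h-sign W eulerian B@(S , ∣S∣) with tripleton S ∣S∣
  ... | x , y , z , xyz , refl with shape xyz
  ...   | transversal _ _ _ x<y y<z B≡ = h-transversal (x<y , y<z) B B≡ W
  ...   | paired _ _ i≢iz B≡ = h-paired i≢iz B B≡ W eulerian

-- Containment of a pair as a quadratic weight

-- As the three points differ, at most one of the deltas is 1 and the sum does not overcount.
ind-∈-tri : ∀ (u : Fin v) {x y z} → Distinct x y z →
            ind (u ∈? tri x y z) ≡ δ u x ℤ.+ δ u y ℤ.+ δ u z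
ind-∈-tri u {x} {y} {z} (distinct x≢y x≢z y≢z) with u ∈? tri x y z
... | no u∉
  rewrite δ-≢ {x = u} {x} (λ { refl → u∉ (∈-tri₁ x y z) })
        | δ-≢ {x = u} {y} (λ { refl → u∉ (∈-tri₂ x y z) })
        | δ-≢ {x = u} {z} (λ { refl → u∉ (∈-tri₃ x y z) }) = refl
... | yes u∈ with ∈-tri⁻ u∈
...   | inj₁ refl rewrite δ-≡ {x = x} refl | δ-≢ x≢y | δ-≢ x≢z = refl
...   | inj₂ (inj₁ refl) rewrite δ-≡ {x = y} refl | δ-≢ (x≢y ∘ sym) | δ-≢ y≢z = refl
...   | inj₂ (inj₂ refl) rewrite δ-≡ {x = z} refl | δ-≢ (x≢z ∘ sym) | δ-≢ (y≢z ∘ sym) = refl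

ind-⊆ : ∀ (x y : Fin v) (S : Subset v) →
        ind ((⁅ x ⁆ ∪ ⁅ y ⁆) ⊆? S) ≡ ind (x ∈? S) ℤ.* ind (y ∈? S)
ind-⊆ x y S with x ∈? S | y ∈? S
... | no x∉S | _ = ind-no ((⁅ x ⁆ ∪ ⁅ y ⁆) ⊆? S) λ ⊆S → x∉S (⊆S (x∈p∪q⁺ (inj₁ (x∈⁅x⁆ x))))
... | yes _  | no y∉S =
  ind-no ((⁅ x ⁆ ∪ ⁅ y ⁆) ⊆? S) λ ⊆S → y∉S (⊆S (x∈p∪q⁺ {p = ⁅ x ⁆} (inj₂ (x∈⁅x⁆ y))))
... | yes x∈S | yes y∈S = ind-yes ((⁅ x ⁆ ∪ ⁅ y ⁆) ⊆? S) λ u∈ →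
  [ (λ u∈x → subst (_∈ˢ S) (sym (x∈⁅y⁆⇒x≡y x u∈x)) x∈S)
  , (λ u∈y → subst (_∈ˢ S) (sym (x∈⁅y⁆⇒x≡y y u∈y)) y∈S) ]′ (x∈p∪q⁻ ⁅ x ⁆ ⁅ y ⁆ u∈)

-- Containing both points is the product of two membership indicators, and each of these is additive
-- over the points of the block.
pair-weight-quadratic : ∀ (x y : Fin v) →
  IsQuadratic (λ S → ind ((⁅ x ⁆ ∪ ⁅ y ⁆) ⊆? S)) (δ x) (δ y)
pair-weight-quadratic x y {x′} {y′} {z′} xyz =
  trans (ind-⊆ x y (tri x′ y′ z′)) (cong₂ ℤ._*_ (ind-∈-tri x xyz) (ind-∈-tri y xyz))

h-balanced : ∀ {a b : Fin N → Fin v} → IsPartition a b → ∀ {G : Graph N} (W : ClosedWalk G) (A : Block v 2) →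
             Σ[ filter (λ B → proj₁ A ⊆? proj₁ B) (blocks v 3) ] (h a b W) ≡ 0ℤ
h-balanced {v = v} {a} {b} partition W (A , ∣A∣) with doubleton A ∣A∣
... | x , y , _ , refl =
  trans (Σ-filter (λ B → A ⊆? proj₁ B) (blocks v 3) (h a b W))
        (Partitioned.⟨⟩-h partition (λ S → ind (A ⊆? S)) (δ x) (δ y) (pair-weight-quadratic x y) W)

-- A constant weight is quadratic when it is a multiple of 9 = (1 + 1 + 1)².
h-total : ∀ {a b : Fin N → Fin v} → IsPartition a b → ∀ {G : Graph N} (W : ClosedWalk G) →
          Σ[ blocks v 3 ] (h a b W) ≡ 0ℤ
h-total {v = v} {a} {b} partition W = ℤ.*-cancelˡ-≡ (+ 9) _ _
  (trans (sym (Σ-*ˡ (blocks v 3) (+ 9) (h a b W)))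
         (Partitioned.⟨⟩-h partition (λ _ → + 9) (λ _ → 1ℤ) (λ _ → 1ℤ) (λ _ → refl) W))

theorem2p1 : (n : ℕ) → 0 < n →
    (a b : Fin (2 * n + 1) → Fin (4 * n + 2)) → IsPartition a b →
    (C : ClosedWalk (complete (2 * n + 1))) → IsEulerian C →
    IsHalving 2 3 (4 * n + 2) (h a b C)
theorem2p1 n 0<n a b partition C eulerian = record
  { isTrade = record
    { t≤k      = ℕ.n≤1+n 2
    -- 5 ≤ 6 = 4 · 1 + 2 ≤ 4n + 2, the last step by 1 ≤ n.
    ; k+t≤v    = ℕ.≤-trans (ℕ.n≤1+n 5) (ℕ.+-monoˡ-≤ 2 (ℕ.*-monoʳ-≤ 4 0<n))
    ; balanced = h-balanced partition C
    }
  ; isSimple = λ B → map₂ inj₂ (h-sign C eulerian B)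
  ; volume   = signs-volume (h a b C) (h-sign C eulerian) (h-total partition C)
  }
  where open Partitioned partition
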